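{- Let $n\ge 1$ and $1\le k\le n$ be integers. Suppose that there is a shape-preserving injection $f: I_{n,k-1}\times I_{n,k+1}\to I_{n,k}^2$. Then there is a shape-preserving injection $F: L_{n,k-1}\times L_{n,k+1}\to L_{n,k}^2$.
   Context: $\mathfrak S_n$ is the symmetric group of all permutations of $[n]=\{1,\dots,n\}$, written in one-line notation, and $\mathfrak I_n\subseteq\mathfrak S_n$ is the set of involutions, i.e. permutations whose square is the identity. For $\pi\in\mathfrak S_n$, $\ell(\pi)$ denotes the length of a longest increasing subsequence of $\pi$. Put $L_{n,k}=\{\pi\in\mathfrak S_n : \ell(\pi)=k\}$ and $I_{n,k}=\{\pi\in\mathfrak I_n : \ell(\pi)=k\}$. For a set $X$, $X^2=X\times X$. The Robinson–Schensted correspondence is the standard bijection from $\mathfrak S_n$ to pairs $(P,Q)$ of standard Young tableaux with $n$ cells and of the same shape. The shape $\operatorname{sh}\pi$ of a permutation $\pi$ is the common shape (a partition of $n$) of the two tableaux $P,Q$ corresponding to $\pi$. For a pair of permutations, $\operatorname{sh}(\pi,\sigma)=(\operatorname{sh}\pi,\operatorname{sh}\sigma)$. A map $F: L_{n,k-1}\times L_{n,k+1}\to L_{n,k}^2$ is called shape preserving if for all $(\pi,\pi'),(\sigma,\sigma')$ in its domain, $\operatorname{sh}(\pi,\pi')=\operatorname{sh}(\sigma,\sigma')$ implies $\operatorname{sh}F(\pi,\pi')=\operatorname{sh}F(\sigma,\sigma')$. The same terminology is used for maps $f: I_{n,k-1}\times I_{n,k+1}\to I_{n,k}^2$. -}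

module Defs where

open import Level using (0ℓ)
open import Data.Fin.Base using (Fin; toℕ)
open import Data.Fin.Permutation using (Permutation′; _⟨$⟩ʳ_; _∘ₚ_; _≈_; id)
open import Data.List.Base using (List; []; _∷_; [_]; _∷ʳ_; length; map; tabulate)
open import Data.List.Relation.Binary.Sublist.Propositional using (_⊆_)
open import Data.List.Relation.Unary.Linked using (Linked)
open import Data.Maybe.Base using (Maybe; just; nothing)
open import Data.Nat.Base using (ℕ; zero; suc; _<_; _≤_)
open import Data.Nat.Properties using (_<?_)
open import Data.Product.Base using (Σ; ∃-syntax; _×_; _,_; proj₁; proj₂)
open import Relation.Binary.Bundles using (Setoid)
import Relation.Binary.Construct.On as On
open import Relation.Binary.PropositionalEquality using (_≡_; _→-setoid_)
open import Relation.Nullary.Decidable using (yes; no)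

-- One-line notation π(1) ⋯ π(n), with Fin n read as {1,…,n}.
word : ∀ {n} → Permutation′ n → List ℕ
word π = tabulate (λ i → suc (toℕ (π ⟨$⟩ʳ i)))

IsInvolution : ∀ {n} → Permutation′ n → Set
IsInvolution π = π ∘ₚ π ≈ id

HasIncreasingSubsequence : List ℕ → ℕ → Set
HasIncreasingSubsequence w k = ∃[ u ] (u ⊆ w × Linked _<_ u × length u ≡ k)

-- ℓ π ≡ k, as a relation between π and k.
ℓ_Is_ : ∀ {n} → Permutation′ n → ℕ → Set
ℓ π Is k =
  HasIncreasingSubsequence (word π) k ×
  (∀ m → HasIncreasingSubsequence (word π) m → m ≤ k)

-- Sets of permutations. Two elements are equal when they are the same map
-- Fin n → Fin n; the inverse map and the membership proof are ignored.
PermSetoid : ∀ n → (Permutation′ n → Set) → Setoid 0ℓ 0ℓ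
PermSetoid n A = On.setoid {B = Σ (Permutation′ n) A} (Fin n →-setoid Fin n)
                           (λ x → proj₁ x ⟨$⟩ʳ_)

L : ℕ → ℕ → Setoid 0ℓ 0ℓ
L n k = PermSetoid n (λ π → ℓ π Is k)

I : ℕ → ℕ → Setoid 0ℓ 0ℓ
I n k = PermSetoid n (λ π → IsInvolution π × ℓ π Is k)

-- A tableau is the list of its rows, top row first, in English notation.
Tableau : Set
Tableau = List (List ℕ)

-- x replaces the leftmost entry greater than x, which is returned, or is
-- placed at the end of the row if there is none.
rowInsert : ℕ → List ℕ → List ℕ × Maybe ℕ
rowInsert x []       = [ x ] , nothing
rowInsert x (y ∷ ys) with x <? y
... | yes _ = x ∷ ys , just y
... | no  _ with rowInsert x ys
...   | ys′ , bumped = y ∷ ys′ , bumped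

-- Also returns the (0-based) index of the row that received the new cell.
insert : ℕ → Tableau → Tableau × ℕ
insert x []       = [ [ x ] ] , 0
insert x (r ∷ rs) with rowInsert x r
... | r′ , nothing = r′ ∷ rs , 0
... | r′ , just y with insert y rs
...   | rs′ , i = r′ ∷ rs′ , suc i

-- Adds the entry j at the end of row i. In the correspondence i is at most
-- the number of rows, so the third clause is never reached.
addAtRow : ℕ → ℕ → Tableau → Tableau
addAtRow zero    j []       = [ [ j ] ]
addAtRow zero    j (r ∷ rs) = (r ∷ʳ j) ∷ rs
addAtRow (suc i) j []       = [ [ j ] ]
addAtRow (suc i) j (r ∷ rs) = r ∷ addAtRow i j rs

-- Inserts the letters of a word into (P , Q), recording the new cells by
-- j, j + 1, ….
insertWord : ℕ → Tableau × Tableau → List ℕ → Tableau × Tableau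
insertWord j (P , Q) []       = P , Q
insertWord j (P , Q) (x ∷ xs) with insert x P
... | P′ , i = insertWord (suc j) (P′ , addAtRow i j Q) xs

robinsonSchensted : ∀ {n} → Permutation′ n → Tableau × Tableau
robinsonSchensted π = insertWord 1 ([] , []) (word π)

-- P and Q have the same shape, so reading it off P is no loss.
sh : ∀ {n} → Permutation′ n → List ℕ
sh π = map length (proj₁ (robinsonSchensted π))

module _ {n : ℕ} where

  sh² : {A B : Permutation′ n → Set} →
        Σ (Permutation′ n) A × Σ (Permutation′ n) B → List ℕ × List ℕ
  sh² (π , σ) = sh (proj₁ π) , sh (proj₁ σ)

  ShapePreserving : {A B C D : Permutation′ n → Set} →
    (Σ (Permutation′ n) A × Σ (Permutation′ n) B →
     Σ (Permutation′ n) C × Σ (Permutation′ n) D) → Set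
  ShapePreserving f = ∀ p q → sh² p ≡ sh² q → sh² (f p) ≡ sh² (f q)

{-# OPTIONS --safe #-}
module Submission where

-- The Robinson–Schensted tableaux of π are read off Fomin's growth diagram, in which
-- the corner (i , j) carries the shape of the word formed by the values ≤ j among the
-- first i letters. Each edge is labelled by the row of the cell added along it, and the
-- labels of one cell determine each other by a local rule that is bijective and symmetric
-- under transposition. The far sides of the diagram carry P(π) and Q(π); hence inversion
-- exchanges P and Q, so that involutions are the permutations with P = Q, and running
-- the rule backwards produces a permutation from any P and Q of the same shape.
--
-- Given f, map (π , π′) first to the involutions with tableaux P(π), P(π′) and to those
-- with tableaux Q(π), Q(π′). Applying f to both pairs gives tableaux A, B and C, D, where
-- A, C and B, D agree in shape because f is shape preserving. The image of (π , π′) is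
-- the pair of permutations with tableaux (A , C) and (B , D). Its members have the right
-- ℓ by Schensted's theorem.

open import Defs
open import Data.Bool.Base using (Bool; true; false)
open import Data.Bool.Properties using (¬-not)
open import Data.Fin.Base using (Fin; zero; suc; toℕ; fromℕ<)
open import Data.Fin.Permutation as Perm using (Permutation′; _⟨$⟩ʳ_; _⟨$⟩ˡ_; _≈_; permutation; inverseˡ; inverseʳ)
open import Data.Fin.Properties using (any?; toℕ<n; toℕ-fromℕ<; toℕ-injective)
open import Data.List.Base using (List; []; _∷_; [_]; _∷ʳ_; _++_; length; map; tabulate; foldl)
open import Data.List.Membership.Propositional using (_∈_; _∉_)
open import Data.List.Membership.Propositional.Properties using (∈-++⁺ʳ; ∈-++⁻)
open import Data.List.Properties using (length-++; ++-assoc; ++-identityʳ)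
open import Data.List.Relation.Binary.Sublist.Propositional as Sublist using (_⊆_; []; _∷_; ⊆-refl; lookup)
open import Data.List.Relation.Binary.Sublist.Propositional.Properties using (++⁺; ++⁺ʳ; ++⁺ˡ)
open import Data.List.Relation.Unary.All as All using (All; []; _∷_)
import Data.List.Relation.Unary.All.Properties as All
open import Data.List.Relation.Unary.AllPairs using ([]; _∷_)
open import Data.List.Relation.Unary.Any using (here)
open import Data.List.Relation.Unary.Linked using (Linked; []; [-]; _∷_)
open import Data.List.Relation.Unary.Unique.Propositional using (Unique)
import Data.List.Relation.Unary.Unique.Propositional.Properties as Unique
open import Data.Maybe.Base using (Maybe; just; nothing)
open import Data.Nat.Base using (ℕ; zero; suc; _+_; _∸_; _⊓_; _≤_; _<_; z≤n; s≤s)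
open import Data.Nat.Properties
open import Data.Product.Base using (Σ-syntax; ∃-syntax; _×_; _,_; proj₁; proj₂)
open import Data.Product.Relation.Binary.Pointwise.NonDependent using (_×ₛ_)
open import Data.Sum.Base using (inj₁; inj₂)
open import Function.Base using (flip; _∘_)
open import Function.Bundles using (Injection)
open import Relation.Binary.Bundles using (Setoid)
open import Relation.Binary.Definitions using (tri<; tri≈; tri>)
open import Relation.Binary.PropositionalEquality hiding ([_])
open import Relation.Nullary using (Dec; does; yes; no; contradiction)
open import Relation.Nullary.Decidable using (_×-dec_; dec-true)

-- Growth diagrams

Label : Set
Label = Maybe ℕ

Matrix : Set
Matrix = ℕ → ℕ → Bool

-- Row bumping in the local rule: a cell whose row is claimed by the other side goes to the next
-- row.
deflect : ℕ → ℕ → ℕ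
deflect zero    zero    = 1
deflect zero    (suc r) = zero
deflect (suc s) zero    = suc s
deflect (suc s) (suc r) = suc (deflect s r)

deflect-same : ∀ s → deflect s s ≡ suc s
deflect-same zero    = refl
deflect-same (suc s) = cong suc (deflect-same s)

deflect-distinct : ∀ {s r} → s ≢ r → deflect s r ≡ s
deflect-distinct {zero}  {zero}  s≢r = contradiction refl s≢r
deflect-distinct {zero}  {suc r} s≢r = refl
deflect-distinct {suc s} {zero}  s≢r = refl
deflect-distinct {suc s} {suc r} s≢r = cong suc (deflect-distinct (s≢r ∘ cong suc))

-- The local rule. If b says whether a cell contains a point of the permutation, and c and t
-- are the labels of its two near sides, then the sides opposite to those carry out b c t
-- and out b t c.
out : Bool → Label → Label → Label
out true  _        _        = just 0
out false nothing  _        = nothing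
out false (just s) nothing  = just s
out false (just s) (just r) = just (deflect s r)

lower : ℕ → Label
lower zero    = nothing
lower (suc s) = just s

-- Runs `out` backwards: from the far sides `c` and `t` it finds the near side opposite to `c`. A
-- common label `just (suc s)` comes from the common label `just s`; a common `just 0` comes from a
-- point, with no label on either near side.
undo : Label → Label → Label
undo nothing  _        = nothing
undo (just s) nothing  = just s
undo (just s) (just r) with s ≟ r
... | yes _ = lower s
... | no  _ = just s

undo-same : ∀ s → undo (just s) (just s) ≡ lower s
undo-same s with s ≟ s
... | yes _   = refl
... | no  s≢s = contradiction refl s≢s

undo-distinct : ∀ {s r} → s ≢ r → undo (just s) (just r) ≡ just s
undo-distinct {s} {r} s≢r with s ≟ r
... | yes s≡r = contradiction s≡r s≢r
... | no  _   = refl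

point : Label → Label → Bool
point (just zero) (just zero) = true
point _           _           = false

point-comm : ∀ c t → point c t ≡ point t c
point-comm nothing        nothing        = refl
point-comm nothing        (just zero)    = refl
point-comm nothing        (just (suc _)) = refl
point-comm (just zero)    nothing        = refl
point-comm (just zero)    (just zero)    = refl
point-comm (just zero)    (just (suc _)) = refl
point-comm (just (suc _)) nothing        = refl
point-comm (just (suc _)) (just zero)    = refl
point-comm (just (suc _)) (just (suc _)) = refl

point⇒0 : ∀ c t → point c t ≡ true → c ≡ just 0 × t ≡ just 0
point⇒0 (just zero) (just zero) _ = refl , refl

point-distinct : ∀ {s r} → s ≢ r → point (just s) (just r) ≡ false
point-distinct {zero}  {zero}  s≢r = contradiction refl s≢r
point-distinct {zero}  {suc r} s≢r = refl
point-distinct {suc s} {r}     s≢r = refl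

out-undo : ∀ c t → out (point c t) (undo c t) (undo t c) ≡ c
out-undo nothing        t       = refl
out-undo (just zero)    nothing = refl
out-undo (just (suc s)) nothing = refl
out-undo (just s) (just r) with s ≟ r
... | no  s≢r rewrite point-distinct s≢r | undo-distinct (s≢r ∘ sym) | deflect-distinct s≢r = refl
out-undo (just zero)    (just r) | yes refl = refl
out-undo (just (suc s)) (just r) | yes refl rewrite undo-same (suc s) | deflect-same s = refl

-- At a point `out` forgets `c` and `t`; it can be inverted there because a rook placement has no
-- labels before its points.
Inert : Bool → Label → Label → Set
Inert b c t = b ≡ true → c ≡ nothing × t ≡ nothing

undo-out : ∀ b c t → Inert b c t → undo (out b c t) (out b t c) ≡ c
undo-out true  c        t        e = sym (proj₁ (e refl))
undo-out false nothing  t        e = refl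
undo-out false (just s) nothing  e = refl
undo-out false (just s) (just r) e with s ≟ r
... | yes refl rewrite deflect-same s = undo-same (suc s)
... | no  s≢r  rewrite deflect-distinct s≢r | deflect-distinct (s≢r ∘ sym) = undo-distinct s≢r

point-out : ∀ b c t → Inert b c t → point (out b c t) (out b t c) ≡ b
point-out true  c        t        e = refl
point-out false nothing  t        e = refl
point-out false (just zero)    nothing  e = refl
point-out false (just (suc s)) nothing  e = refl
point-out false (just s) (just r) e with s ≟ r
... | yes refl rewrite deflect-same s = refl
... | no  s≢r  rewrite deflect-distinct s≢r | deflect-distinct (s≢r ∘ sym) = point-distinct s≢r

-- label M i j is the row in which the shape at the corner (i + 1 , j) exceeds the shape at
-- (i , j), and label (flip M) j i the row in which the shape at (i , j + 1) exceeds it;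
-- nothing if the two shapes are equal.
label : Matrix → ℕ → ℕ → Label
label M i zero    = nothing
label M i (suc j) = out (M i j) (label M i j) (label (flip M) j i)

AgreeBelow : ℕ → Matrix → Matrix → Set
AgreeBelow n M N = ∀ i j → i < n → j < n → M i j ≡ N i j

label-cong : ∀ {n M N} → AgreeBelow n M N → ∀ i j → i < n → j ≤ n → label M i j ≡ label N i j
label-cong M≗N i zero    i<n j≤n = refl
label-cong M≗N i (suc j) i<n j<n
  rewrite M≗N i j i<n j<n
        | label-cong M≗N i j i<n (<⇒≤ j<n)
        | label-cong (λ i j i<n j<n → M≗N j i j<n i<n) j i j<n (<⇒≤ i<n) = refl

record Rook (M : Matrix) : Set where
  field
    row    : ∀ {i j j′} → M i j ≡ true → M i j′ ≡ true → j ≡ j′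
    column : ∀ {i i′ j} → M i j ≡ true → M i′ j ≡ true → i ≡ i′

open Rook

transpose : ∀ {M} → Rook M → Rook (flip M)
transpose ρ = record { row = column ρ ; column = row ρ }

label-before : ∀ {M i j} → (∀ j′ → j′ < j → M i j′ ≡ false) → label M i j ≡ nothing
label-before {M} {i} {zero}  M≡false = refl
label-before {M} {i} {suc j} M≡false
  rewrite M≡false j ≤-refl | label-before {M} {i} {j} (λ j′ j′<j → M≡false j′ (m≤n⇒m≤1+n j′<j)) = refl

label-at : ∀ {M} → Rook M → ∀ i j → M i j ≡ true → label M i j ≡ nothing
label-at ρ i j Mij = label-before λ j′ j′<j → ¬-not λ Mij′ → <⇒≢ j′<j (row ρ Mij′ Mij)

inert : ∀ {M} → Rook M → ∀ i j → Inert (M i j) (label M i j) (label (flip M) j i)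
inert ρ i j Mij = label-at ρ i j Mij , label-at (transpose ρ) j i Mij

-- The local rule is run backwards from the far sides. `a` and `b` are the distances to them; the
-- transposed call swaps the two, and their sum decreases.
label-determined : ∀ {n M N} → Rook M → Rook N →
  (∀ i → i < n → label M i n ≡ label N i n) →
  (∀ j → j < n → label (flip M) j n ≡ label (flip N) j n) →
  ∀ a b i j → suc i + a ≡ n → j + b ≡ n → label M i j ≡ label N i j
label-determined {n} {M} {N} ρ σ p q a zero i j ia jb
  rewrite +-identityʳ j | jb = p i (subst (i <_) ia (m≤m+n (suc i) a))
label-determined {n} {M} {N} ρ σ p q a (suc b) i j ia jb = begin
  label M i j
    ≡⟨ undo-out (M i j) _ _ (inert ρ i j) ⟨
  undo (label M i (suc j)) (label (flip M) j (suc i))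
    ≡⟨ cong₂ undo (label-determined ρ σ p q a b i (suc j) ia jb′)
                  (label-determined (transpose ρ) (transpose σ) q p b a j (suc i) jb′ ia) ⟩
  undo (label N i (suc j)) (label (flip N) j (suc i))
    ≡⟨ undo-out (N i j) _ _ (inert σ i j) ⟩
  label N i j ∎
  where
  open ≡-Reasoning
  jb′ : suc j + b ≡ n
  jb′ = trans (sym (+-suc j b)) jb

-- The injectivity of the correspondence: the far sides fix all labels, and `point-out` reads the
-- points off the labels.
matrix-determined : ∀ {n M N} → Rook M → Rook N →
  (∀ i → i < n → label M i n ≡ label N i n) →
  (∀ j → j < n → label (flip M) j n ≡ label (flip N) j n) →
  AgreeBelow n M N
matrix-determined {n} {M} {N} ρ σ p q i j i<n j<n = begin
  M i j
    ≡⟨ point-out (M i j) _ _ (inert ρ i j) ⟨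
  point (label M i (suc j)) (label (flip M) j (suc i))
    ≡⟨ cong₂ point (label-determined ρ σ p q _ _ i (suc j) ia jb)
                   (label-determined (transpose ρ) (transpose σ) q p _ _ j (suc i) jb ia) ⟩
  point (label N i (suc j)) (label (flip N) j (suc i))
    ≡⟨ point-out (N i j) _ _ (inert σ i j) ⟩
  N i j ∎
  where
  open ≡-Reasoning
  ia : suc i + (n ∸ suc i) ≡ n
  ia = m+[n∸m]≡n i<n
  jb : suc j + (n ∸ suc j) ≡ n
  jb = m+[n∸m]≡n j<n

-- Shapes at the corners

unit : ℕ → ℕ → ℕ
unit zero    zero    = 1
unit zero    (suc r) = 0
unit (suc s) zero    = 0
unit (suc s) (suc r) = unit s r

unit-same : ∀ s → unit s s ≡ 1
unit-same zero    = refl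
unit-same (suc s) = unit-same s

unit-distinct : ∀ {s r} → s ≢ r → unit s r ≡ 0
unit-distinct {zero}  {zero}  s≢r = contradiction refl s≢r
unit-distinct {zero}  {suc r} s≢r = refl
unit-distinct {suc s} {zero}  s≢r = refl
unit-distinct {suc s} {suc r} s≢r = unit-distinct (s≢r ∘ cong suc)

box : Label → ℕ → ℕ
box nothing  r = 0
box (just s) r = unit s r

box≡0⇒nothing : ∀ c → (∀ r → box c r ≡ 0) → c ≡ nothing
box≡0⇒nothing nothing  e = refl
box≡0⇒nothing (just s) e with trans (sym (unit-same s)) (e s)
... | ()

-- Both ways around a square of the diagram add the same cells, so the shape at a corner does not
-- depend on the path taken to it.
box-out : ∀ b c t → Inert b c t → ∀ r → box (out b t c) r + box c r ≡ box (out b c t) r + box t r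
box-out true  c        t        e r rewrite proj₁ (e refl) | proj₂ (e refl) = refl
box-out false nothing  nothing  e r = refl
box-out false nothing  (just _) e r = +-identityʳ _
box-out false (just _) nothing  e r = sym (+-identityʳ _)
box-out false (just s) (just t) e r with s ≟ t
... | yes refl = refl
... | no  s≢t rewrite deflect-distinct s≢t | deflect-distinct (s≢t ∘ sym) = +-comm (unit t r) (unit s r)

count : (ℕ → Label) → ℕ → ℕ → ℕ
count w zero    r = 0
count w (suc j) r = box (w j) r + count w j r

count-cong : ∀ {v w} n → (∀ j → j < n → v j ≡ w j) → ∀ r → count v n r ≡ count w n r
count-cong zero    v≗w r = refl
count-cong (suc n) v≗w r = cong₂ (λ c k → box c r + k) (v≗w n ≤-refl)
  (count-cong n (λ j j<n → v≗w j (m≤n⇒m≤1+n j<n)) r)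

-- The number of cells in row r of the shape at the corner (i , j).
corner : Matrix → ℕ → ℕ → ℕ → ℕ
corner M i = count (λ j → label (flip M) j i)

-- `corner` counts only along edges with `i` fixed. Carrying an edge in the other direction across
-- one square at a time, by `box-out`, shows that its label too is the difference of two shapes.
corner-suc : ∀ {M} → Rook M → ∀ i j r → corner M (suc i) j r ≡ box (label M i j) r + corner M i j r
corner-suc     ρ i zero    r = refl
corner-suc {M} ρ i (suc j) r = begin
  box (out (M i j) V H) r + corner M (suc i) j r
    ≡⟨ cong (box (out (M i j) V H) r +_) (corner-suc ρ i j r) ⟩
  box (out (M i j) V H) r + (box H r + corner M i j r)
    ≡⟨ +-assoc (box (out (M i j) V H) r) (box H r) _ ⟨
  box (out (M i j) V H) r + box H r + corner M i j r
    ≡⟨ cong (_+ corner M i j r) (box-out (M i j) H V (inert ρ i j) r) ⟩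
  box (out (M i j) H V) r + box V r + corner M i j r
    ≡⟨ +-assoc (box (out (M i j) H V) r) (box V r) _ ⟩
  box (out (M i j) H V) r + (box V r + corner M i j r) ∎
  where
  open ≡-Reasoning
  H = label M i j
  V = label (flip M) j i

corner-zero : ∀ {M} j r → corner M 0 j r ≡ 0
corner-zero zero    r = refl
corner-zero {M} (suc j) r = corner-zero {M} j r

corner-transpose : ∀ {M} → Rook M → ∀ i j r → corner M i j r ≡ corner (flip M) j i r
corner-transpose {M} ρ zero    j r = corner-zero {M} j r
corner-transpose {M} ρ (suc i) j r =
  trans (corner-suc ρ i j r) (cong (box (label M i j) r +_) (corner-transpose ρ i j r))

Antitone : (ℕ → ℕ) → Set
Antitone f = ∀ r → f (suc r) ≤ f r

Antitone-cong : ∀ {f g} → (∀ r → f r ≡ g r) → Antitone f → Antitone g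
Antitone-cong f≗g f↘ r = subst₂ _≤_ (f≗g (suc r)) (f≗g r) (f↘ r)

infixl 6 _⊕_
_⊕_ : Label → (ℕ → ℕ) → ℕ → ℕ
(c ⊕ f) r = box c r + f r

-- Labels in distinct rows lead to the union of the two neighbouring partitions. A common row `s`
-- sends a second cell to row `s + 1`, where the cell just added above makes room for it. A point
-- lengthens row 0, which is always allowed.
antitone-step : ∀ b c t {f} → Inert b c t → Antitone f → Antitone (c ⊕ f) → Antitone (t ⊕ f) →
                Antitone (out b c t ⊕ (t ⊕ f))
antitone-step true c t e f↘ cf↘ tf↘ r rewrite proj₂ (e refl) = ≤-trans (f↘ r) (m≤n+m _ (unit 0 r))
antitone-step false nothing  t       e f↘ cf↘ tf↘ = tf↘
antitone-step false (just s) nothing e f↘ cf↘ tf↘ = cf↘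
antitone-step false (just s) (just t) {f} e f↘ cf↘ tf↘ r with s ≟ t
antitone-step false (just s) (just s) {f} e f↘ cf↘ tf↘ r | yes refl
  rewrite deflect-same s with s ≟ r
... | yes refl rewrite unit-same s | unit-distinct {s} {suc s} (<⇒≢ ≤-refl) =
  ≤-trans (s≤s (f↘ s)) (m≤n+m _ (unit (suc s) s))
... | no  s≢r rewrite unit-distinct s≢r =
  ≤-trans (cf↘ r) (≤-trans (≤-reflexive (cong (_+ f r) (unit-distinct s≢r))) (m≤n+m _ (unit (suc s) r)))
antitone-step false (just s) (just t) {f} e f↘ cf↘ tf↘ r | no s≢t
  rewrite deflect-distinct s≢t with s ≟ suc r
... | yes refl rewrite unit-distinct (s≢t ∘ sym) =
  ≤-trans (cf↘ r) (+-monoʳ-≤ (unit (suc r) r) (m≤n+m _ (unit t r)))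
... | no  s≢r rewrite unit-distinct s≢r = ≤-trans (tf↘ r) (m≤n+m _ (unit s r))

corner-antitone : ∀ {M} → Rook M → ∀ i j → Antitone (corner M i j)
corner-antitone     ρ i       zero    r = z≤n
corner-antitone {M} ρ zero    (suc j) = corner-antitone ρ zero j
corner-antitone {M} ρ (suc i) (suc j) =
  Antitone-cong (λ r → sym (corner-suc ρ i (suc j) r))
    (antitone-step (M i j) (label M i j) (label (flip M) j i) (inert ρ i j)
      (corner-antitone ρ i j)
      (Antitone-cong (corner-suc ρ i j) (corner-antitone ρ (suc i) j))
      (corner-antitone ρ i (suc j)))

-- The converse of antitone-step: f, g, h are the shapes at the far corner of a cell and
-- at its neighbours, c and t the labels between them. The shape k at the near corner is
-- the intersection of g and h, unless c = t = just (suc s); then g = h, and k is g without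
-- the last cell of row s.
antitone-undo : ∀ c t {f g h} → (∀ r → f r ≡ (t ⊕ g) r) → (∀ r → f r ≡ (c ⊕ h) r) →
  Antitone f → Antitone g → Antitone h →
  Σ[ k ∈ (ℕ → ℕ) ] (∀ r → g r ≡ (undo c t ⊕ k) r) × (∀ r → h r ≡ (undo t c ⊕ k) r) × Antitone k
antitone-undo nothing t {g = g} f≡g f≡h f↘ g↘ h↘ =
  g , (λ r → refl) , (λ r → trans (sym (f≡h r)) (trans (f≡g r) (cong (λ t → box t r + g r) (undo-nothing t)))) , g↘
  where
  undo-nothing : ∀ t → t ≡ undo t nothing
  undo-nothing nothing  = refl
  undo-nothing (just _) = refl
antitone-undo (just s) nothing {h = h} f≡g f≡h f↘ g↘ h↘ =
  h , (λ r → trans (sym (f≡g r)) (f≡h r)) , (λ r → refl) , h↘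
antitone-undo (just s) (just t) f≡g f≡h f↘ g↘ h↘ with s ≟ t
antitone-undo (just zero) (just zero) {g = g} f≡g f≡h f↘ g↘ h↘ | yes refl =
  g , (λ r → refl) , (λ r → +-cancelˡ-≡ (unit 0 r) _ _ (trans (sym (f≡h r)) (f≡g r))) , g↘
antitone-undo (just (suc s)) (just (suc s)) {f} {g} {h} f≡g f≡h f↘ g↘ h↘ | yes refl
  rewrite undo-same (suc s) = (λ r → g r ∸ unit s r) , g≡ , (λ r → trans (sym (g≡h r)) (g≡ r)) , k↘
  where
  g≡h : ∀ r → g r ≡ h r
  g≡h r = +-cancelˡ-≡ (unit (suc s) r) _ _ (trans (sym (f≡g r)) (f≡h r))
  gs : g (suc s) < g s
  gs = subst₂ _≤_ (trans (f≡g (suc s)) (cong (_+ g (suc s)) (unit-same s)))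
                  (trans (f≡g s) (cong (_+ g s) (unit-distinct {suc s} (1+n≢n))))
                  (f↘ s)
  fits : ∀ r → unit s r ≤ g r
  fits r with s ≟ r
  ... | yes refl rewrite unit-same s = ≤-trans (s≤s z≤n) gs
  ... | no  s≢r  rewrite unit-distinct s≢r = z≤n
  g≡ : ∀ r → g r ≡ unit s r + (g r ∸ unit s r)
  g≡ r = sym (m+[n∸m]≡n (fits r))
  k↘ : Antitone (λ r → g r ∸ unit s r)
  k↘ r with s ≟ r
  ... | yes refl rewrite unit-same s = ≤-trans (m∸n≤m _ (unit s (suc s))) (∸-monoˡ-≤ 1 gs)
  ... | no  s≢r  rewrite unit-distinct s≢r = ≤-trans (m∸n≤m _ (unit s (suc r))) (g↘ r)
antitone-undo (just s) (just t) {f} {g} {h} f≡g f≡h f↘ g↘ h↘ | no s≢t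
  rewrite undo-distinct (s≢t ∘ sym) =
  (λ r → g r ⊓ h r) , meetˡ g h s≢t f≡g f≡h ,
  (λ r → trans (meetˡ h g (s≢t ∘ sym) f≡h f≡g r) (cong (unit t r +_) (⊓-comm (h r) (g r)))) ,
  (λ r → ⊓-mono-≤ (g↘ r) (h↘ r))
  where
  meetˡ : ∀ {s t} g h → s ≢ t → (∀ r → f r ≡ unit t r + g r) → (∀ r → f r ≡ unit s r + h r) →
          ∀ r → g r ≡ unit s r + (g r ⊓ h r)
  meetˡ {s} {t} g h s≢t f≡g f≡h r with s ≟ r
  ... | yes refl rewrite unit-same s =
    trans g≡1+h (cong suc (sym (m≥n⇒m⊓n≡n (≤-trans (n≤1+n _) (≤-reflexive (sym g≡1+h))))))
    where
    g≡1+h : g s ≡ 1 + h s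
    g≡1+h = trans (trans (cong (_+ g s) (sym (unit-distinct (s≢t ∘ sym)))) (trans (sym (f≡g s)) (f≡h s)))
                  (cong (_+ h s) (unit-same s))
  ... | no  s≢r rewrite unit-distinct s≢r = sym (m≤n⇒m⊓n≡m (≤-trans (m≤n+m (g r) (unit t r))
                  (≤-reflexive (trans (sym (f≡g r)) (trans (f≡h r) (cong (_+ h r) (unit-distinct s≢r)))))))

-- Reversing a growth diagram

-- The value `nothing` past the end lets `count-reversed` hold for every `b`, as `n ∸ b` is then 0.
reversed : ℕ → (ℕ → Label) → ℕ → Label
reversed zero    w b       = nothing
reversed (suc n) w zero    = w n
reversed (suc n) w (suc b) = reversed n w b

∸-step : ∀ {i n} → i < n → n ∸ i ≡ suc (n ∸ suc i)
∸-step {n = suc n} (s≤s i≤n) = +-∸-assoc 1 i≤n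

reversed-∸ : ∀ {n} w {i} → i < n → reversed n w (n ∸ suc i) ≡ w i
reversed-∸ {suc n} w {i} (s≤s i≤n) with m≤n⇒m<n∨m≡n i≤n
... | inj₁ i<n  rewrite ∸-step i<n = reversed-∸ w i<n
... | inj₂ refl rewrite n∸n≡0 i = refl

count-reversed : ∀ n w b r → count w (n ∸ b) r ≡ (reversed n w b ⊕ count w (n ∸ suc b)) r
count-reversed zero    w zero    r = refl
count-reversed zero    w (suc b) r = refl
count-reversed (suc n) w zero    r = refl
count-reversed (suc n) w (suc b) r = count-reversed n w b r

-- The labels found by running the local rule backwards from labels q and p on the far
-- sides, with corners counted from the far corner.
retro : (q p : ℕ → Label) → ℕ → ℕ → Label
retro q p a zero    = q a
retro q p a (suc b) = undo (retro q p a b) (retro p q b a)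

-- One far side of a diagram as a decreasing chain of partitions, starting at the far corner.
record Chain (p : ℕ → Label) (f : ℕ → ℕ → ℕ) : Set where
  field
    step     : ∀ b r → f b r ≡ (p b ⊕ f (suc b)) r
    antitone : ∀ b → Antitone (f b)

count-chain : ∀ {n w} → (∀ j → Antitone (count w j)) → Chain (reversed n w) (λ b → count w (n ∸ b))
count-chain {n} {w} w↘ = record { step = count-reversed n w ; antitone = λ b → w↘ (n ∸ b) }

module _ {q p : ℕ → Label} {g f : ℕ → ℕ → ℕ} (Q : Chain q g) (P : Chain p f)
         (start : ∀ r → f 0 r ≡ g 0 r) where

  private
    shape : ℕ → ℕ → ℕ → ℕ
    shape zero    b r = f b r
    -- The subtraction never truncates, by `shape-q`.
    shape (suc a) b r = shape a b r ∸ box (retro q p a b) r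

    shape-side : ∀ a r → shape a 0 r ≡ g a r
    shape-side zero    r = start r
    shape-side (suc a) r rewrite shape-side a r | Chain.step Q a r = m+n∸m≡n (box (q a) r) _

    Opposite : ℕ → ℕ → Set
    Opposite a b = Σ[ k ∈ (ℕ → ℕ) ] (∀ r → shape a (suc b) r ≡ (retro q p a (suc b) ⊕ k) r) ×
                                    (∀ r → shape (suc a) b r ≡ (retro p q b (suc a) ⊕ k) r) × Antitone k

    opposite≡shape : ∀ a b (o : Opposite a b) r → proj₁ o r ≡ shape (suc a) (suc b) r
    opposite≡shape a b (k , e , _) r rewrite e r = sym (m+n∸m≡n (box (retro q p a (suc b)) r) _)

    -- Proved together, square by square: from the three known shapes `antitone-undo` makes a fourth
    -- partition, and `opposite≡shape` identifies it with `shape (suc a) (suc b)`.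
    shape-antitone : ∀ a b → Antitone (shape a b)
    shape-p : ∀ a b r → shape a b r ≡ (retro p q b a ⊕ shape a (suc b)) r
    shape-q : ∀ a b r → shape a b r ≡ (retro q p a b ⊕ shape (suc a) b) r

    opposite : ∀ a b → Opposite a b
    opposite a b = antitone-undo (retro q p a b) (retro p q b a) (shape-p a b) (shape-q a b)
      (shape-antitone a b) (shape-antitone a (suc b)) (shape-antitone (suc a) b)

    shape-antitone zero    b       = Chain.antitone P b
    shape-antitone (suc a) zero    = Antitone-cong (λ r → sym (shape-side (suc a) r)) (Chain.antitone Q (suc a))
    shape-antitone (suc a) (suc b) = Antitone-cong (opposite≡shape a b o) (proj₂ (proj₂ (proj₂ o)))
      where o = opposite a b

    shape-p zero    b r = Chain.step P b r
    shape-p (suc a) b r = trans (proj₁ (proj₂ (proj₂ o)) r)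
                                (cong (box (retro p q b (suc a)) r +_) (opposite≡shape a b o r))
      where o = opposite a b

    shape-q a zero    r = trans (shape-side a r) (trans (Chain.step Q a r)
                                (cong (box (q a) r +_) (sym (shape-side (suc a) r))))
    shape-q a (suc b) r = trans (proj₁ (proj₂ o) r)
                                (cong (box (retro q p a (suc b)) r +_) (opposite≡shape a b o r))
      where o = opposite a b

    shape-empty : ∀ {b} → (∀ r → f b r ≡ 0) → ∀ a r → shape a b r ≡ 0
    shape-empty e zero    r = e r
    shape-empty {b} e (suc a) r rewrite shape-empty e a r = 0∸n≡0 (box (retro q p a b) r)

  -- Shapes only shrink on the way back, so they stay empty beyond an empty shape on the side, and
  -- no label there can remove a cell. Hence the reversed diagram begins with empty shapes.
  retro-exit : ∀ {b} → (∀ r → f b r ≡ 0) → ∀ a → retro q p a b ≡ nothing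
  retro-exit e a = box≡0⇒nothing _ λ r →
    m+n≡0⇒m≡0 _ (trans (sym (shape-q a _ r)) (shape-empty e a r))

Reverses : ℕ → Matrix → (q p : ℕ → Label) → Set
Reverses n M q p = ∀ i j → i < n → j < n →
  M i j ≡ point (retro q p (n ∸ suc i) (n ∸ suc j)) (retro p q (n ∸ suc j) (n ∸ suc i))

-- Forward induction from the empty near sides; in each square `out-undo` gives back the labels of
-- the backward run.
label-retro : ∀ {n M q p} → Reverses n M q p →
  (∀ a → retro q p a n ≡ nothing) → (∀ b → retro p q b n ≡ nothing) →
  ∀ i j → i < n → j ≤ n → label M i j ≡ retro q p (n ∸ suc i) (n ∸ j)
label-retro {n} R q∅ p∅ i zero    i<n j≤n = sym (q∅ (n ∸ suc i))
label-retro {n} {M} {q} {p} R q∅ p∅ i (suc j) i<n j<n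
  rewrite R i j i<n j<n
        | label-retro R q∅ p∅ i j i<n (<⇒≤ j<n)
        | label-retro {n} {flip M} {p} {q}
            (λ j i j<n i<n → trans (R i j i<n j<n) (point-comm (retro q p (n ∸ suc i) (n ∸ suc j)) _))
            p∅ q∅ j i j<n (<⇒≤ i<n)
        | ∸-step i<n | ∸-step j<n = out-undo (retro q p (n ∸ suc i) (n ∸ suc j)) _

label-reach : ∀ {M i} j {c} → label M i j ≡ just c → ∃[ j′ ] j′ < j × M i j′ ≡ true
label-reach {M} {i} (suc j) e with M i j in Mij
... | true = j , ≤-refl , Mij
... | false with label M i j in lab
...   | just _ with label-reach {M} {i} j lab
...     | j′ , j′<j , t = j′ , m≤n⇒m≤1+n j′<j , t

out-just : ∀ b c t → c ≢ nothing → out b c t ≢ nothing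
out-just false nothing  t        c≢ = c≢
out-just false (just _) nothing  c≢ ()
out-just false (just _) (just _) c≢ ()

label-after : ∀ {M i j} j′ → j < j′ → M i j ≡ true → label M i j′ ≢ nothing
label-after {M} {i} (suc j′) (s≤s j≤j′) Mij with m≤n⇒m<n∨m≡n j≤j′
... | inj₁ j<j′ = out-just (M i j′) _ _ (label-after j′ j<j′ Mij)
... | inj₂ refl rewrite Mij = λ ()

-- Permutations

does⇒ : ∀ {a} {A : Set a} (A? : Dec A) → does A? ≡ true → A
does⇒ (yes a) _ = a

true⇔true : ∀ {b c : Bool} → (b ≡ true → c ≡ true) → (c ≡ true → b ≡ true) → b ≡ c
true⇔true {true}          b⇒c c⇒b = sym (b⇒c refl)
true⇔true {false} {true}  b⇒c c⇒b = c⇒b refl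
true⇔true {false} {false} b⇒c c⇒b = refl

infix 4 _≗[_]_
_≗[_]_ : (ℕ → Label) → ℕ → (ℕ → Label) → Set
p ≗[ n ] q = ∀ i → i < n → p i ≡ q i

≗-sym : ∀ {n p q} → p ≗[ n ] q → q ≗[ n ] p
≗-sym e i i<n = sym (e i i<n)

≗-trans : ∀ {n p q r} → p ≗[ n ] q → q ≗[ n ] r → p ≗[ n ] r
≗-trans e e′ i i<n = trans (e i i<n) (e′ i i<n)

module _ {n : ℕ} where

  matrix : Permutation′ n → Matrix
  matrix π i j = does (any? λ x → (toℕ x ≟ i) ×-dec (toℕ (π ⟨$⟩ʳ x) ≟ j))

  Graph : Permutation′ n → ℕ → ℕ → Set
  Graph π i j = ∃[ x ] toℕ x ≡ i × toℕ (π ⟨$⟩ʳ x) ≡ j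

  matrix⇒ : ∀ π {i j} → matrix π i j ≡ true → Graph π i j
  matrix⇒ π = does⇒ (any? _)

  ⇒matrix : ∀ π {i j} → Graph π i j → matrix π i j ≡ true
  ⇒matrix π = dec-true (any? _)

  matrix-⟨$⟩ʳ : ∀ π x → matrix π (toℕ x) (toℕ (π ⟨$⟩ʳ x)) ≡ true
  matrix-⟨$⟩ʳ π x = ⇒matrix π (x , refl , refl)

  ⟨$⟩ʳ-injective : ∀ (π : Permutation′ n) {x y} → π ⟨$⟩ʳ x ≡ π ⟨$⟩ʳ y → x ≡ y
  ⟨$⟩ʳ-injective π e = trans (sym (inverseˡ π)) (trans (cong (π ⟨$⟩ˡ_) e) (inverseˡ π))

  rook : ∀ π → Rook (matrix π)
  rook π = record { row = row′ ; column = column′ }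
    where
    row′ : ∀ {i j j′} → matrix π i j ≡ true → matrix π i j′ ≡ true → j ≡ j′
    row′ Mij Mij′ with matrix⇒ π Mij | matrix⇒ π Mij′
    ... | x , refl , refl | y , y≡x , refl = cong (λ z → toℕ (π ⟨$⟩ʳ z)) (toℕ-injective (sym y≡x))
    column′ : ∀ {i i′ j} → matrix π i j ≡ true → matrix π i′ j ≡ true → i ≡ i′
    column′ Mij Mi′j with matrix⇒ π Mij | matrix⇒ π Mi′j
    ... | x , refl , refl | y , refl , πy≡πx = cong toℕ (⟨$⟩ʳ-injective π (toℕ-injective (sym πy≡πx)))

  matrix-cong : ∀ π σ → π ≈ σ → ∀ i j → matrix π i j ≡ matrix σ i j
  matrix-cong π σ π≈σ i j = true⇔true
    (⇒matrix σ ∘ to π σ π≈σ ∘ matrix⇒ π)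
    (⇒matrix π ∘ to σ π (sym ∘ π≈σ) ∘ matrix⇒ σ)
    where
    to : ∀ π σ → π ≈ σ → Graph π i j → Graph σ i j
    to π σ π≈σ (x , refl , refl) = x , refl , cong toℕ (sym (π≈σ x))

  matrix-flip : ∀ π i j → matrix (Perm.flip π) i j ≡ matrix π j i
  matrix-flip π i j = true⇔true
    (⇒matrix π ∘ to ∘ matrix⇒ (Perm.flip π))
    (⇒matrix (Perm.flip π) ∘ from ∘ matrix⇒ π)
    where
    to : Graph (Perm.flip π) i j → Graph π j i
    to (x , refl , refl) = _ , refl , cong toℕ (inverseʳ π)
    from : Graph π j i → Graph (Perm.flip π) i j
    from (x , refl , refl) = _ , refl , cong toℕ (inverseˡ π)

  matrix-injective : ∀ π σ → AgreeBelow n (matrix π) (matrix σ) → π ≈ σ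
  matrix-injective π σ M≗N x = toℕ-injective
    (Rook.row (rook σ)
      (trans (sym (M≗N _ _ (toℕ<n x) (toℕ<n (π ⟨$⟩ʳ x)))) (matrix-⟨$⟩ʳ π x))
      (matrix-⟨$⟩ʳ σ x))

  -- The entry j + 1 of P(π) is in row P π j, and likewise for Q(π); rows are counted from 0.
  P Q : Permutation′ n → ℕ → Label
  P π j = label (flip (matrix π)) j n
  Q π i = label (matrix π) i n

  Q-cong : ∀ π σ → π ≈ σ → Q π ≗[ n ] Q σ
  Q-cong π σ π≈σ i i<n = label-cong (λ i j _ _ → matrix-cong π σ π≈σ i j) i n i<n ≤-refl

  P-cong : ∀ π σ → π ≈ σ → P π ≗[ n ] P σ
  P-cong π σ π≈σ j j<n = label-cong (λ j i _ _ → matrix-cong π σ π≈σ i j) j n j<n ≤-refl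

  -- Inversion transposes the matrix and thereby exchanges the far sides of the diagram.
  P-flip : ∀ π → P (Perm.flip π) ≗[ n ] Q π
  P-flip π i i<n = label-cong (λ i j _ _ → matrix-flip π j i) i n i<n ≤-refl

  Q-flip : ∀ π → Q (Perm.flip π) ≗[ n ] P π
  Q-flip π j j<n = label-cong (λ j i _ _ → matrix-flip π j i) j n j<n ≤-refl

  PQ-injective : ∀ π σ → P π ≗[ n ] P σ → Q π ≗[ n ] Q σ → π ≈ σ
  PQ-injective π σ p q = matrix-injective π σ (matrix-determined (rook π) (rook σ) q p)

  Q-total : ∀ π i → i < n → Q π i ≢ nothing
  Q-total π i i<n = label-after n (toℕ<n (π ⟨$⟩ʳ x))
    (subst (λ i → matrix π i (toℕ (π ⟨$⟩ʳ x)) ≡ true) (toℕ-fromℕ< i<n) (matrix-⟨$⟩ʳ π x))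
    where x = fromℕ< i<n

  P-total : ∀ π j → j < n → P π j ≢ nothing
  P-total π j j<n e = Q-total (Perm.flip π) j j<n (trans (Q-flip π j j<n) e)

  -- Unlike `Rook`, this constrains only indices below `n`: beyond them truncated subtraction makes
  -- the matrix of a reversed diagram repeat its last row and column.
  record Full (M : Matrix) : Set where
    field
      reach  : ∀ i → i < n → ∃[ j ] j < n × M i j ≡ true
      unique : ∀ {i j j′} → i < n → j < n → j′ < n → M i j ≡ true → M i j′ ≡ true → j ≡ j′

  module _ {M : Matrix} (R : Full M) (C : Full (flip M)) where
    open Full

    private
      act : ∀ {M} → Full M → Fin n → Fin n
      act F x = fromℕ< (proj₁ (proj₂ (reach F (toℕ x) (toℕ<n x))))

      act-true : ∀ {M} (F : Full M) x → M (toℕ x) (toℕ (act F x)) ≡ true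
      act-true F x with reach F (toℕ x) (toℕ<n x)
      ... | j , j<n , Mxj rewrite toℕ-fromℕ< j<n = Mxj

      act-act : ∀ {M} (F : Full M) (G : Full (flip M)) x → act F (act G x) ≡ x
      act-act F G x = toℕ-injective
        (unique F (toℕ<n (act G x)) (toℕ<n (act F (act G x))) (toℕ<n x) (act-true F (act G x)) (act-true G x))

    fullPermutation : Permutation′ n
    fullPermutation = permutation (act R) (act C) (act-act R C) (act-act C R)

    matrix-fullPermutation : AgreeBelow n (matrix fullPermutation) M
    matrix-fullPermutation i j i<n j<n = true⇔true (to ∘ matrix⇒ fullPermutation) (⇒matrix fullPermutation ∘ from)
      where
      to : Graph fullPermutation i j → M i j ≡ true
      to (x , refl , refl) = act-true R x
      from : M i j ≡ true → Graph fullPermutation i j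
      from Mij = fromℕ< i<n , toℕ-fromℕ< i<n , unique R i<n (toℕ<n (act R (fromℕ< i<n))) j<n
        (subst (λ i → M i (toℕ (act R (fromℕ< i<n))) ≡ true) (toℕ-fromℕ< i<n) (act-true R (fromℕ< i<n))) Mij

  module _ {M q p} (R : Reverses n M q p)
           (q∅ : ∀ a → retro q p a n ≡ nothing) (p∅ : ∀ b → retro p q b n ≡ nothing)
           (total : ∀ i → i < n → q (n ∸ suc i) ≢ nothing) where

    -- The last label of each row comes from `q`, hence is not `nothing`, and a label can only arise
    -- from a point.
    full-reverse : Full M
    full-reverse = record { reach = reach′ ; unique = unique′ }
      where
      reach′ : ∀ i → i < n → ∃[ j ] j < n × M i j ≡ true
      reach′ i i<n with q (n ∸ suc i) in qi
      ... | nothing = contradiction qi (total i i<n)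
      ... | just c  = label-reach n (trans (label-retro R q∅ p∅ i n i<n ≤-refl)
                        (trans (cong (retro q p (n ∸ suc i)) (n∸n≡0 n)) qi))

      -- A point at `j′` makes both far labels of its square `just 0`, which `undo` turns into
      -- `nothing`; but after the point at `j` the label of the row is never `nothing`.
      later : ∀ {i j j′} → i < n → j′ < n → j < j′ → M i j ≡ true → M i j′ ≢ true
      later {i} {j} {j′} i<n j′<n j<j′ Mij Mij′ = label-after j′ j<j′ Mij (begin
        label M i j′
          ≡⟨ label-retro R q∅ p∅ i j′ i<n (<⇒≤ j′<n) ⟩
        retro q p (n ∸ suc i) (n ∸ j′)
          ≡⟨ cong (retro q p (n ∸ suc i)) (∸-step j′<n) ⟩
        undo (retro q p (n ∸ suc i) (n ∸ suc j′)) (retro p q (n ∸ suc j′) (n ∸ suc i))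
          ≡⟨ cong₂ undo (proj₁ zeros) (proj₂ zeros) ⟩
        nothing ∎)
        where
        open ≡-Reasoning
        zeros = point⇒0 _ _ (trans (sym (R i j′ i<n j′<n)) Mij′)

      unique′ : ∀ {i j j′} → i < n → j < n → j′ < n → M i j ≡ true → M i j′ ≡ true → j ≡ j′
      unique′ {i} {j} {j′} i<n j<n j′<n Mij Mij′ with <-cmp j j′
      ... | tri< j<j′ _ _ = contradiction Mij′ (later i<n j′<n j<j′ Mij)
      ... | tri≈ _ j≡j′ _ = j≡j′
      ... | tri> _ _ j′<j = contradiction Mij (later i<n j<n j′<j Mij′)

  size : Permutation′ n → ℕ → ℕ
  size π = corner (matrix π) n n

  size-flip : ∀ π r → size (Perm.flip π) r ≡ size π r
  size-flip π r = trans (count-cong n (P-flip π) r) (sym (corner-transpose (rook π) n n r))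

  -- The surjectivity of the correspondence. Both tableaux are given through permutations, whose
  -- growth diagrams supply the chains of partitions needed on the far sides.
  recombine : ∀ α γ → (∀ r → size α r ≡ size γ r) →
    Σ[ σ ∈ Permutation′ n ] P σ ≗[ n ] P α × Q σ ≗[ n ] Q γ
  recombine α γ same = σ ,
    (λ j j<n → trans (label-cong (λ j i j<n i<n → matrix-fullPermutation full fullᵀ i j i<n j<n) j n j<n ≤-refl)
                     (end (P α) Rᵀ p∅ q∅ j<n)) ,
    (λ i i<n → trans (label-cong (matrix-fullPermutation full fullᵀ) i n i<n ≤-refl)
                     (end (Q γ) R q∅ p∅ i<n))
    where
    p q : ℕ → Label
    p = reversed n (P α)
    q = reversed n (Q γ)
    M : Matrix
    M i j = point (retro q p (n ∸ suc i) (n ∸ suc j)) (retro p q (n ∸ suc j) (n ∸ suc i))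
    R : Reverses n M q p
    R i j _ _ = refl
    Rᵀ : Reverses n (flip M) p q
    Rᵀ j i _ _ = point-comm (retro q p (n ∸ suc i) (n ∸ suc j)) _
    chainP : Chain p (λ b → count (P α) (n ∸ b))
    chainP = count-chain (corner-antitone (rook α) n)
    chainQ : Chain q (λ b → count (Q γ) (n ∸ b))
    chainQ = count-chain (corner-antitone (transpose (rook γ)) n)
    start : ∀ r → count (P α) n r ≡ count (Q γ) n r
    -- The two chains meet at the far corner: the shape of `γ` can also be counted along its Q side.
    start r = trans (same r) (corner-transpose (rook γ) n n r)
    empty : ∀ w r → count w (n ∸ n) r ≡ 0
    empty w r rewrite n∸n≡0 n = refl
    q∅ : ∀ a → retro q p a n ≡ nothing
    q∅ = retro-exit chainQ chainP start {n} (empty (P α))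
    p∅ : ∀ b → retro p q b n ≡ nothing
    p∅ = retro-exit chainP chainQ (sym ∘ start) {n} (empty (Q γ))
    full : Full M
    full = full-reverse R q∅ p∅ λ i i<n → Q-total γ i i<n ∘ trans (sym (reversed-∸ (Q γ) i<n))
    fullᵀ : Full (flip M)
    fullᵀ = full-reverse Rᵀ p∅ q∅ λ j j<n → P-total α j j<n ∘ trans (sym (reversed-∸ (P α) j<n))
    σ : Permutation′ n
    σ = fullPermutation full fullᵀ
    end : ∀ {M p} w → (let q = reversed n w) → Reverses n M q p →
      (∀ a → retro q p a n ≡ nothing) → (∀ b → retro p q b n ≡ nothing) →
      ∀ {i} → i < n → label M i n ≡ w i
    end {p = p} w R q∅ p∅ {i} i<n = trans (label-retro R q∅ p∅ i n i<n ≤-refl)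
      (trans (cong (retro (reversed n w) p (n ∸ suc i)) (n∸n≡0 n)) (reversed-∸ w i<n))

-- Insertion

-- Unlike addAtRow this pads with empty rows, so that the entry always lands in row r.
place : ℕ → ℕ → Tableau → Tableau
place zero    z []       = [ [ z ] ]
place zero    z (row ∷ T) = (row ∷ʳ z) ∷ T
place (suc r) z []       = [] ∷ place r z []
place (suc r) z (row ∷ T) = row ∷ place r z T

placeLabel : Label → ℕ → Tableau → Tableau
placeLabel nothing  z T = T
placeLabel (just r) z T = place r z T

-- Values are entered in increasing order, each at the end of its row; a value not yet read has
-- label `nothing` and is left out.
build : (ℕ → Label) → ℕ → Tableau
build w zero    = []
build w (suc j) = placeLabel (w j) (suc j) (build w j)

Below : ℕ → Tableau → Set
Below z = All (All (_< z))

place-below : ∀ r {y z T} → y < z → Below z T → Below z (place r y T)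
place-below zero    y<z []         = (y<z ∷ []) ∷ []
place-below zero    y<z (row ∷ T)  = All.∷ʳ⁺ row y<z ∷ T
place-below (suc r) y<z []         = [] ∷ place-below r y<z []
place-below (suc r) y<z (row ∷ T)  = row ∷ place-below r y<z T

build-below : ∀ w j → Below (suc j) (build w j)
build-below w zero    = []
build-below w (suc j) with w j
... | nothing = All.map (All.map m≤n⇒m≤1+n) (build-below w j)
... | just r  = place-below r ≤-refl (All.map (All.map m≤n⇒m≤1+n) (build-below w j))

rowInsert-top : ∀ {x row} → All (_< x) row → rowInsert x row ≡ (row ∷ʳ x , nothing)
rowInsert-top []                          = refl
rowInsert-top {x} {y ∷ row} (y<x ∷ row<x) with x <? y
... | yes x<y = contradiction x<y (<-asym y<x)
... | no  _ rewrite rowInsert-top row<x = refl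

insert-top : ∀ {x T} → Below x T → insert x T ≡ (place 0 x T , 0)
insert-top []                 = refl
insert-top {x} (row<x ∷ T<x) rewrite rowInsert-top row<x = refl

afterBump : ℕ → List ℕ × Maybe ℕ → List ℕ × Maybe ℕ
afterBump z (row , nothing) = row , just z
afterBump z (row , just y)  = row ∷ʳ z , just y

-- Either `x` bumps an entry of `row` and never meets `z`, or it would have been appended and now
-- bumps `z`.
rowInsert-∷ʳ : ∀ {x z} row → x < z → rowInsert x (row ∷ʳ z) ≡ afterBump z (rowInsert x row)
rowInsert-∷ʳ {x} {z} [] x<z with x <? z
... | yes _   = refl
... | no  x≮z = contradiction x<z x≮z
rowInsert-∷ʳ {x} (y ∷ row) x<z with x <? y
... | yes _ = refl
... | no  _ rewrite rowInsert-∷ʳ row x<z with rowInsert x row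
...   | row′ , nothing = refl
...   | row′ , just _  = refl

bumped-below : ∀ {x y z row row′} → All (_< z) row → rowInsert x row ≡ (row′ , just y) → y < z
bumped-below {x} {row = w ∷ row} (w<z ∷ row<z) e with x <? w
bumped-below {x} {row = w ∷ row} (w<z ∷ row<z) refl | yes _ = w<z
... | no _ with rowInsert x row in eq
bumped-below {x} {row = w ∷ row} (w<z ∷ row<z) refl | no _ | _ , just _ = bumped-below row<z eq

-- The local rule of the growth diagram: an entry larger than all others gives
-- way exactly when the new cell claims its row.
insert-place : ∀ r {x z} T → x < z → Below z T → let T′ , s = insert x T in
  insert x (place r z T) ≡ (place (deflect r s) z T′ , deflect s r)
insert-place zero {x} {z} [] x<z [] with x <? z
... | yes _   = refl
... | no  x≮z = contradiction x<z x≮z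
insert-place (suc r) [] x<z [] = refl
insert-place zero {x} {z} (row ∷ T) x<z (row<z ∷ T<z)
  rewrite rowInsert-∷ʳ row x<z with rowInsert x row
... | row′ , nothing rewrite insert-top T<z = refl
... | row′ , just y  = refl
insert-place (suc r) {x} {z} (row ∷ T) x<z (row<z ∷ T<z) with rowInsert x row in eq
... | row′ , nothing = refl
... | row′ , just y rewrite insert-place r T (bumped-below row<z eq) T<z = refl

module _ {M} (ρ : Rook M) {i x} (Mix : M i x ≡ true) where

  private
    V : ℕ → ℕ → Label
    V i j = label (flip M) j i

    elsewhere : ∀ {j} → x ≢ j → M i j ≡ false
    elsewhere x≢j = ¬-not λ Mij → x≢j (Rook.row ρ Mix Mij)

    out-nothing : ∀ t → out false t nothing ≡ t
    out-nothing nothing  = refl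
    out-nothing (just _) = refl

  build-before : ∀ j → j ≤ x → build (V (suc i)) j ≡ build (V i) j
  build-before zero    j≤x = refl
  build-before (suc j) j<x
    rewrite label-before {M} {i} {j} (λ j′ j′<j → elsewhere (>⇒≢ (<-trans j′<j j<x)))
          | elsewhere (>⇒≢ j<x)
          | out-nothing (V i j)
          | build-before j (<⇒≤ j<x) = refl

  -- Passing from `i` to `i + 1` in the diagram is row insertion. Induction on the bound `j` for the
  -- values: each value above the inserted letter obeys the local rule, by `insert-place`.
  insert-build : ∀ j → x < j →
    ∃[ s ] label M i j ≡ just s × insert (suc x) (build (V i) j) ≡ (build (V (suc i)) j , s)
  insert-build (suc j) (s≤s x≤j) with m≤n⇒m<n∨m≡n x≤j
  -- Letters count from 1: the tableau for the bound `j = x` has entries at most `x`, so the letter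
  -- `suc x` goes to the end of row 0.
  ... | inj₂ refl rewrite label-at ρ i j Mix | label-at (transpose ρ) j i Mix | Mix
                        | build-before j ≤-refl = 0 , refl , insert-top (build-below (V i) j)
  ... | inj₁ x<j with insert-build j x<j
  ...   | s , lab , eq rewrite lab | elsewhere (<⇒≢ x<j) with V i j
  ...     | nothing = s , refl , eq
  ...     | just r  = deflect s r , refl ,
                      trans (insert-place r (build (V i) j) (s≤s x<j) (build-below (V i) j))
                            (cong (λ (T , s) → place (deflect r s) (suc j) T , deflect s r) eq)

insertWord-P : ∀ k T U xs → proj₁ (insertWord k (T , U) xs) ≡ foldl (λ T x → proj₁ (insert x T)) T xs
insertWord-P k T U []       = refl
insertWord-P k T U (x ∷ xs) = insertWord-P (suc k) _ _ xs

foldl-tabulate : ∀ {a b} {A : Set a} {B : Set b} {_·_ : B → A → B} {n} (s : ℕ → B) (f : Fin n → A) →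
  (∀ i → (s (toℕ i) · f i) ≡ s (suc (toℕ i))) → foldl _·_ (s 0) (tabulate f) ≡ s n
foldl-tabulate {n = zero}  s f e = refl
foldl-tabulate {n = suc n} s f e rewrite e zero = foldl-tabulate (s ∘ suc) (f ∘ suc) (e ∘ suc)

build-zero : ∀ M j → build (λ j → label (flip M) j 0) j ≡ []
build-zero M zero    = refl
build-zero M (suc j) = build-zero M j

insertion-build : ∀ {n} (π : Permutation′ n) → proj₁ (robinsonSchensted π) ≡ build (P π) n
insertion-build {n} π = begin
  proj₁ (robinsonSchensted π)
    ≡⟨ insertWord-P 1 [] [] (word π) ⟩
  foldl step [] (word π)
    ≡⟨ cong (λ T → foldl step T (word π)) (build-zero (matrix π) n) ⟨
  foldl step (stage 0) (word π)
    ≡⟨ foldl-tabulate stage _ (λ i → cong proj₁ (proj₂ (proj₂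
         (insert-build (rook π) (matrix-⟨$⟩ʳ π i) n (toℕ<n (π ⟨$⟩ʳ i)))))) ⟩
  build (P π) n ∎
  where
  open ≡-Reasoning
  step = λ T x → proj₁ (insert x T)
  stage : ℕ → Tableau
  stage i = build (λ j → label (flip (matrix π)) j i) n

-- Shapes as sequences of row lengths

entry : List ℕ → ℕ → ℕ
entry []       r       = 0
entry (l ∷ ls) zero    = l
entry (l ∷ ls) (suc r) = entry ls r

entry-place : ∀ s z T r → entry (map length (place s z T)) r ≡ unit s r + entry (map length T) r
entry-place zero    z []        zero    = refl
entry-place zero    z []        (suc r) = refl
entry-place zero    z (row ∷ T) zero    = trans (length-++ row) (+-comm (length row) 1)
entry-place zero    z (row ∷ T) (suc r) = refl
entry-place (suc s) z []        zero    = refl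
entry-place (suc s) z []        (suc r) = entry-place s z [] r
entry-place (suc s) z (row ∷ T) zero    = refl
entry-place (suc s) z (row ∷ T) (suc r) = entry-place s z T r

entry-build : ∀ w j r → entry (map length (build w j)) r ≡ count w j r
entry-build w zero    r = refl
entry-build w (suc j) r with w j
... | nothing = entry-build w j r
... | just s  = trans (entry-place s (suc j) (build w j) r) (cong (unit s r +_) (entry-build w j r))

rowInsert-positive : ∀ x row → 0 < length (proj₁ (rowInsert x row))
rowInsert-positive x []        = s≤s z≤n
rowInsert-positive x (y ∷ row) with x <? y
... | yes _ = s≤s z≤n
... | no  _ = s≤s z≤n

insert-positive : ∀ x {T} → All (0 <_) (map length T) → All (0 <_) (map length (proj₁ (insert x T)))
insert-positive x {[]}      []          = s≤s z≤n ∷ []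
insert-positive x {row ∷ T} (row>0 ∷ T>0) with rowInsert x row | rowInsert-positive x row
... | row′ , nothing | row′>0 = row′>0 ∷ T>0
... | row′ , just y  | row′>0 = row′>0 ∷ insert-positive y T>0

insertions-positive : ∀ xs {T} → All (0 <_) (map length T) →
  All (0 <_) (map length (foldl (λ T x → proj₁ (insert x T)) T xs))
insertions-positive []       T>0 = T>0
insertions-positive (x ∷ xs) {T} T>0 = insertions-positive xs (insert-positive x {T} T>0)

-- Positivity excludes trailing zeros, which `entry` cannot see.
entry-injective : ∀ {ks ls} → All (0 <_) ks → All (0 <_) ls → (∀ r → entry ks r ≡ entry ls r) → ks ≡ ls
entry-injective []          []          e = refl
entry-injective []          (l>0 ∷ ls)  e = contradiction (e 0) (<⇒≢ l>0)
entry-injective (k>0 ∷ ks)  []          e = contradiction (sym (e 0)) (<⇒≢ k>0)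
entry-injective (k>0 ∷ ks)  (l>0 ∷ ls)  e = cong₂ _∷_ (e 0) (entry-injective ks ls (e ∘ suc))

module _ {n : ℕ} where

  sh-positive : ∀ (π : Permutation′ n) → All (0 <_) (sh π)
  sh-positive π rewrite insertWord-P 1 [] [] (word π) = insertions-positive (word π) []

  entry-sh : ∀ (π : Permutation′ n) r → entry (sh π) r ≡ size π r
  entry-sh π r rewrite insertion-build π = entry-build (P π) n r

  sh⇒size : ∀ (π σ : Permutation′ n) → sh π ≡ sh σ → ∀ r → size π r ≡ size σ r
  sh⇒size π σ e r = trans (sym (entry-sh π r)) (trans (cong (λ s → entry s r) e) (entry-sh σ r))

  size⇒sh : ∀ (π σ : Permutation′ n) → (∀ r → size π r ≡ size σ r) → sh π ≡ sh σ
  size⇒sh π σ e = entry-injective (sh-positive π) (sh-positive σ)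
    (λ r → trans (entry-sh π r) (trans (e r) (sym (entry-sh σ r))))

  sh-flip : ∀ (π : Permutation′ n) → sh (Perm.flip π) ≡ sh π
  sh-flip π = size⇒sh (Perm.flip π) π (size-flip π)

  P⇒sh : ∀ (π σ : Permutation′ n) → P π ≗[ n ] P σ → sh π ≡ sh σ
  P⇒sh π σ p = size⇒sh π σ (count-cong n p)

-- Schensted's theorem

insertInRow : List ℕ → ℕ → List ℕ
insertInRow row x = proj₁ (rowInsert x row)

position : ℕ → List ℕ → ℕ
position x []        = 0
position x (y ∷ row) with x <? y
... | yes _ = 0
... | no  _ = suc (position x row)

-- Insertion replaces an entry by a smaller one or appends, so no letter lands further left than
-- before.
position-mono : ∀ u x row → position u row ≤ position u (insertInRow row x)
position-mono u x []        = z≤n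
position-mono u x (y ∷ row) with x <? y
... | no  _ with u <? y
...   | yes _ = z≤n
...   | no  _ = s≤s (position-mono u x row)
position-mono u x (y ∷ row) | yes x<y with u <? y
...   | yes _   = z≤n
...   | no  u≮y with u <? x
...     | yes u<x = contradiction (<-trans u<x x<y) u≮y
...     | no  _   = ≤-refl

position-later : ∀ {u x} row → x < u → position x row < position u (insertInRow row x)
position-later {u} {x} [] x<u with u <? x
... | yes u<x = contradiction x<u (<-asym u<x)
... | no  _   = s≤s z≤n
position-later {u} {x} (y ∷ row) x<u with x <? y
... | yes x<y with u <? x
...   | yes u<x = contradiction x<u (<-asym u<x)
...   | no  _   = s≤s z≤n
position-later {u} {x} (y ∷ row) x<u | no x≮y with u <? y
...   | yes u<y = contradiction (<-trans x<u u<y) x≮y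
...   | no  _   = s≤s (position-later row x<u)

position<length : ∀ x row → position x row < length (insertInRow row x)
position<length x []        = s≤s z≤n
position<length x (y ∷ row) with x <? y
... | yes _ = s≤s z≤n
... | no  _ = s≤s (position<length x row)

length-insertInRow : ∀ row x → length row ≤ length (insertInRow row x)
length-insertInRow []        x = z≤n
length-insertInRow (y ∷ row) x with x <? y
... | yes _ = ≤-refl
... | no  _ = s≤s (length-insertInRow row x)

length-foldl : ∀ row w → length row ≤ length (foldl insertInRow row w)
length-foldl row []      = ≤-refl
length-foldl row (x ∷ w) = ≤-trans (length-insertInRow row x) (length-foldl (insertInRow row x) w)

-- The letters of an increasing subsequence land in strictly increasing columns, by
-- `position-later`; the letters between them do no harm, by `position-mono`.
increasing-bound : ∀ {x u} row {w} → Linked _<_ (x ∷ u) → (x ∷ u) ⊆ w →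
  position x row + length (x ∷ u) ≤ length (foldl insertInRow row w)
increasing-bound {x} row x∷u↗ (y Sublist.∷ʳ x∷u⊆w) =
  ≤-trans (+-monoˡ-≤ _ (position-mono x y row)) (increasing-bound (insertInRow row y) x∷u↗ x∷u⊆w)
increasing-bound {x} row {_ ∷ w} [-] (refl ∷ _) rewrite +-comm (position x row) 1 =
  ≤-trans (position<length x row) (length-foldl (insertInRow row x) w)
increasing-bound {x} {y ∷ u} row (x<y ∷ y∷u↗) (refl ∷ y∷u⊆w)
  rewrite +-suc (position x row) (length (y ∷ u)) =
  ≤-trans (+-monoˡ-≤ _ (position-later row x<y)) (increasing-bound (insertInRow row x) y∷u↗ y∷u⊆w)

-- Some increasing subsequence of d ends in z and has k letters before z.
Reaches : List ℕ → ℕ → ℕ → Set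
Reaches d k z = ∃[ u ] Linked _<_ (u ∷ʳ z) × (u ∷ʳ z) ⊆ d × length u ≡ k

reaches-∈ : ∀ {d k z} → Reaches d k z → z ∈ d
reaches-∈ (u , _ , uz⊆d , _) = lookup uz⊆d (∈-++⁺ʳ u (here refl))

reaches-weaken : ∀ {d k z} x → Reaches d k z → Reaches (d ∷ʳ x) k z
reaches-weaken x (u , uz↗ , uz⊆d , e) = u , uz↗ , ++⁺ʳ (x ∷ []) uz⊆d , e

linked-∷ʳ : ∀ u {z x} → Linked _<_ (u ∷ʳ z) → z < x → Linked _<_ ((u ∷ʳ z) ∷ʳ x)
linked-∷ʳ []          [-]         z<x = z<x ∷ [-]
linked-∷ʳ (y ∷ [])    (y<z ∷ [-]) z<x = y<z ∷ z<x ∷ [-]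
linked-∷ʳ (y ∷ v ∷ u) (y<v ∷ uz↗) z<x = y<v ∷ linked-∷ʳ (v ∷ u) uz↗ z<x

reaches-extend : ∀ {d k z x} → z < x → Reaches d k z → Reaches (d ∷ʳ x) (suc k) x
reaches-extend {z = z} z<x (u , uz↗ , uz⊆d , refl) =
  u ∷ʳ z , linked-∷ʳ u uz↗ z<x , ++⁺ uz⊆d ⊆-refl , trans (length-++ u) (+-comm (length u) 1)

-- The index is the column of the first entry: an entry in column `m` ends an increasing subsequence
-- with `m` letters before it.
data AllReach (d : List ℕ) : ℕ → List ℕ → Set where
  []  : ∀ {k} → AllReach d k []
  _∷_ : ∀ {k y row} → Reaches d k y → AllReach d (suc k) row → AllReach d k (y ∷ row)

allReach-weaken : ∀ {d k row} x → AllReach d k row → AllReach (d ∷ʳ x) k row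
allReach-weaken x []       = []
allReach-weaken x (y ∷ row) = reaches-weaken x y ∷ allReach-weaken x row

-- The new letter extends the subsequence that ends in its left neighbour. The neighbour is strictly
-- smaller because `x` does not occur in `d`.
allReach-insert : ∀ {d k row x} → x ∉ d → Reaches (d ∷ʳ x) k x → AllReach d k row →
  AllReach (d ∷ʳ x) k (insertInRow row x)
allReach-insert x∉d rx [] = rx ∷ []
allReach-insert {row = y ∷ _} {x} x∉d rx (ry ∷ rrow) with x <? y
... | yes _   = rx ∷ allReach-weaken x rrow
... | no  x≮y = reaches-weaken x ry ∷ allReach-insert x∉d (reaches-extend y<x ry) rrow
  where
  y<x : y < x
  y<x = ≤∧≢⇒< (≮⇒≥ x≮y) λ { refl → x∉d (reaches-∈ ry) }

allReach-foldl : ∀ {d row} w → All (_∉ d) w → Unique w → AllReach d 0 row →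
  AllReach (d ++ w) 0 (foldl insertInRow row w)
allReach-foldl {d} [] w∉d uniq reach rewrite ++-identityʳ d = reach
allReach-foldl {d} {row} (x ∷ w) (x∉d ∷ w∉d) (x∉w ∷ uniq) reach
  rewrite sym (++-assoc d (x ∷ []) w) =
  allReach-foldl w (All.zipWith fresh (w∉d , x∉w)) uniq
    (allReach-insert x∉d ([] , [-] , ++⁺ˡ d ⊆-refl , refl) reach)
  where
  fresh : ∀ {z} → z ∉ d × x ≢ z → z ∉ d ∷ʳ x
  fresh (z∉d , x≢z) z∈ with ∈-++⁻ d z∈
  ... | inj₁ z∈d         = z∉d z∈d
  ... | inj₂ (here refl) = x≢z refl

allReach⇒increasing : ∀ {d k row} → HasIncreasingSubsequence d k → AllReach d k row →
  HasIncreasingSubsequence d (k + length row)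
allReach⇒increasing {d} {k} h [] rewrite +-identityʳ k = h
allReach⇒increasing {d} {k} {y ∷ row} h ((u , uy↗ , uy⊆d , refl) ∷ rrow) rewrite +-suc (length u) (length row) =
  allReach⇒increasing (u ∷ʳ y , uy⊆d , uy↗ , trans (length-++ u) (+-comm (length u) 1)) rrow

firstRow : Tableau → List ℕ
firstRow []      = []
firstRow (row ∷ T) = row

firstRow-insert : ∀ x T → firstRow (proj₁ (insert x T)) ≡ insertInRow (firstRow T) x
firstRow-insert x []        = refl
firstRow-insert x (row ∷ T) with rowInsert x row
... | _ , nothing = refl
... | _ , just _  = refl

firstRow-foldl : ∀ w T → firstRow (foldl (λ T x → proj₁ (insert x T)) T w) ≡ foldl insertInRow (firstRow T) w
firstRow-foldl []      T = refl
firstRow-foldl (x ∷ w) T = trans (firstRow-foldl w _) (cong (λ row → foldl insertInRow row w) (firstRow-insert x T))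

entry-firstRow : ∀ T → entry (map length T) 0 ≡ length (firstRow T)
entry-firstRow []      = refl
entry-firstRow (row ∷ T) = refl

module _ {n : ℕ} where

  word-unique : ∀ (π : Permutation′ n) → Unique (word π)
  word-unique π = Unique.tabulate⁺ λ e → trans (sym (inverseˡ π))
    (trans (cong (π ⟨$⟩ˡ_) (toℕ-injective (suc-injective e))) (inverseˡ π))

  entry-sh-0 : ∀ (π : Permutation′ n) → entry (sh π) 0 ≡ length (foldl insertInRow [] (word π))
  entry-sh-0 π = trans (entry-firstRow (proj₁ (robinsonSchensted π)))
    (cong length (trans (cong firstRow (insertWord-P 1 [] [] (word π))) (firstRow-foldl (word π) [])))

  schensted : ∀ (π : Permutation′ n) → ℓ π Is entry (sh π) 0
  schensted π rewrite entry-sh-0 π = longest , bound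
    where
    longest : HasIncreasingSubsequence (word π) (length (foldl insertInRow [] (word π)))
    longest = allReach⇒increasing ([] , ++⁺ʳ (word π) [] , [] , refl)
      (allReach-foldl (word π) (All.universal (λ _ ()) _) (word-unique π) [])
    bound : ∀ m → HasIncreasingSubsequence (word π) m → m ≤ length (foldl insertInRow [] (word π))
    bound _ ([]    , _   , _  , refl) = z≤n
    bound _ (x ∷ u , u⊆w , u↗ , refl) = increasing-bound [] u↗ u⊆w

  ℓ-unique : ∀ (π : Permutation′ n) {k m} → ℓ π Is k → ℓ π Is m → k ≡ m
  ℓ-unique π (hk , k-max) (hm , m-max) = ≤-antisym (m-max _ hk) (k-max _ hm)

  -- By `schensted`, both lengths are the first row of the common shape.
  ℓ-sh : ∀ (π σ : Permutation′ n) {k} → sh π ≡ sh σ → ℓ π Is k → ℓ σ Is k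
  ℓ-sh π σ e π-k = subst (ℓ σ Is_)
    (trans (cong (λ s → entry s 0) (sym e)) (ℓ-unique π (schensted π) π-k))
    (schensted σ)

-- Involutions

module _ {n : ℕ} where

  involution-flip : (π : Permutation′ n) → IsInvolution π → Perm.flip π ≈ π
  involution-flip π ππ i = trans (cong (π ⟨$⟩ˡ_) (sym (ππ i))) (inverseˡ π)

  involution-Q : (π : Permutation′ n) → IsInvolution π → Q π ≗[ n ] P π
  involution-Q π ππ = ≗-trans (≗-sym (P-flip π)) (P-cong (Perm.flip π) π (involution-flip π ππ))

  -- The Q tableau of the inverse is P(π), so the result has P(π) as both of its tableaux.
  symmetrize : (π : Permutation′ n) →
    Σ[ σ ∈ Permutation′ n ] P σ ≗[ n ] P π × Q σ ≗[ n ] Q (Perm.flip π)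
  symmetrize π = recombine π (Perm.flip π) (sym ∘ size-flip π)

  ι : Permutation′ n → Permutation′ n
  ι = proj₁ ∘ symmetrize

  P-ι : ∀ π → P (ι π) ≗[ n ] P π
  P-ι = proj₁ ∘ proj₂ ∘ symmetrize

  Q-ι : ∀ π → Q (ι π) ≗[ n ] P π
  Q-ι π = ≗-trans (proj₂ (proj₂ (symmetrize π))) (Q-flip π)

  sh-ι : ∀ π → sh (ι π) ≡ sh π
  sh-ι π = P⇒sh (ι π) π (P-ι π)

  -- Equal tableaux are unchanged when inversion exchanges them, so `ι π` is its own inverse.
  ι-involution : ∀ π → IsInvolution (ι π)
  ι-involution π i = trans (ι≈flip (ι π ⟨$⟩ʳ i)) (inverseˡ (ι π))
    where
    P≗Q : P (ι π) ≗[ n ] Q (ι π)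
    P≗Q = ≗-trans (P-ι π) (≗-sym (Q-ι π))
    ι≈flip : ι π ≈ Perm.flip (ι π)
    ι≈flip = PQ-injective (ι π) (Perm.flip (ι π))
      (≗-trans P≗Q (≗-sym (P-flip (ι π))))
      (≗-trans (≗-sym P≗Q) (≗-sym (Q-flip (ι π))))

  ι-cong : ∀ π σ → P π ≗[ n ] P σ → ι π ≈ ι σ
  ι-cong π σ p = PQ-injective (ι π) (ι σ)
    (≗-trans (P-ι π) (≗-trans p (≗-sym (P-ι σ))))
    (≗-trans (Q-ι π) (≗-trans p (≗-sym (Q-ι σ))))

  ι-injective : ∀ π σ → ι π ≈ ι σ → P π ≗[ n ] P σ
  ι-injective π σ e = ≗-trans (≗-sym (P-ι π)) (≗-trans (P-cong (ι π) (ι σ) e) (P-ι σ))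

-- Splitting a permutation into two involutions, and joining two involutions

module _ {n k : ℕ} where

  open Setoid using (Carrier)

  involutionP involutionQ : Carrier (L n k) → Carrier (I n k)
  involutionP (π , π-k) = ι π , ι-involution π , ℓ-sh π (ι π) (sym (sh-ι π)) π-k
  -- The P tableau of the inverse is Q(π).
  involutionQ (π , π-k) = ι π⁻¹ , ι-involution π⁻¹ ,
    ℓ-sh π (ι π⁻¹) (sym (trans (sh-ι π⁻¹) (sh-flip π))) π-k
    where π⁻¹ = Perm.flip π

  sh-PQ : ∀ x → sh (proj₁ (involutionP x)) ≡ sh (proj₁ (involutionQ x))
  sh-PQ (π , _) = trans (sh-ι π) (sym (trans (sh-ι (Perm.flip π)) (sh-flip π)))

  open Setoid (L n k) using () renaming (_≈_ to _≈ᴸ_)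
  open Setoid (I n k) using () renaming (_≈_ to _≈ᴵ_)

  involutionP-cong : ∀ x y → x ≈ᴸ y → involutionP x ≈ᴵ involutionP y
  involutionP-cong (π , _) (σ , _) e = ι-cong π σ (P-cong π σ e)

  involutionQ-cong : ∀ x y → x ≈ᴸ y → involutionQ x ≈ᴵ involutionQ y
  involutionQ-cong (π , _) (σ , _) e = ι-cong (Perm.flip π) (Perm.flip σ)
    (≗-trans (P-flip π) (≗-trans (Q-cong π σ e) (≗-sym (P-flip σ))))

  involutionPQ-injective : ∀ x y → involutionP x ≈ᴵ involutionP y → involutionQ x ≈ᴵ involutionQ y → x ≈ᴸ y
  involutionPQ-injective (π , _) (σ , _) eP eQ = PQ-injective π σ (ι-injective π σ eP)
    (≗-trans (≗-sym (P-flip π)) (≗-trans (ι-injective (Perm.flip π) (Perm.flip σ) eQ) (P-flip σ)))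

  module _ (a c : Carrier (I n k)) (same : sh (proj₁ a) ≡ sh (proj₁ c)) where

    private
      α = proj₁ a
      γ = proj₁ c

    joined : Σ[ σ ∈ Permutation′ n ] P σ ≗[ n ] P α × Q σ ≗[ n ] Q γ
    joined = recombine α γ (sh⇒size α γ same)

    sh-joined : sh (proj₁ joined) ≡ sh α
    sh-joined = P⇒sh (proj₁ joined) α (proj₁ (proj₂ joined))

    join : Carrier (L n k)
    join = proj₁ joined , ℓ-sh α (proj₁ joined) (sym sh-joined) (proj₂ (proj₂ a))

  join-cong : ∀ a c s a′ c′ s′ → a ≈ᴵ a′ → c ≈ᴵ c′ → join a c s ≈ᴸ join a′ c′ s′
  join-cong a c s a′ c′ s′ a≈a′ c≈c′ = PQ-injective (proj₁ j) (proj₁ j′)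
    (≗-trans (proj₁ (proj₂ j)) (≗-trans (P-cong (proj₁ a) (proj₁ a′) a≈a′) (≗-sym (proj₁ (proj₂ j′)))))
    (≗-trans (proj₂ (proj₂ j)) (≗-trans (Q-cong (proj₁ c) (proj₁ c′) c≈c′) (≗-sym (proj₂ (proj₂ j′)))))
    where
    j  = joined a c s
    j′ = joined a′ c′ s′

  -- An involution has P = Q, so the one tableau that `join` keeps of it determines it.
  join-injective : ∀ a c s a′ c′ s′ → join a c s ≈ᴸ join a′ c′ s′ → a ≈ᴵ a′ × c ≈ᴵ c′
  join-injective a@(α , αα , _) c@(γ , γγ , _) s a′@(α′ , αα′ , _) c′@(γ′ , γγ′ , _) s′ e =
    PQ-injective α α′ Pα (≗-trans (involution-Q α αα) (≗-trans Pα (≗-sym (involution-Q α′ αα′)))) ,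
    PQ-injective γ γ′ (≗-trans (≗-sym (involution-Q γ γγ)) (≗-trans Qγ (involution-Q γ′ γγ′))) Qγ
    where
    j  = joined a c s
    j′ = joined a′ c′ s′
    Pα : P α ≗[ n ] P α′
    Pα = ≗-trans (≗-sym (proj₁ (proj₂ j))) (≗-trans (P-cong (proj₁ j) (proj₁ j′) e) (proj₁ (proj₂ j′)))
    Qγ : Q γ ≗[ n ] Q γ′
    Qγ = ≗-trans (≗-sym (proj₂ (proj₂ j))) (≗-trans (Q-cong (proj₁ j) (proj₁ j′) e) (proj₂ (proj₂ j′)))

theorem2p2 : (n k : ℕ) → 1 ≤ n → 1 ≤ k → k ≤ n →
    (Σ[ f ∈ Injection (I n (k ∸ 1) ×ₛ I n (suc k)) (I n k ×ₛ I n k) ]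
    ShapePreserving (Injection.to f)) →
    Σ[ F ∈ Injection (L n (k ∸ 1) ×ₛ L n (suc k)) (L n k ×ₛ L n k) ]
    ShapePreserving (Injection.to F)
theorem2p2 n k _ _ _ (f , f-shape) =
  record
    { to        = F
    ; cong      = λ {p} {q} → F-cong p q
    ; injective = λ {p} {q} → F-injective p q
    } , F-shape
  where
  open Setoid using (Carrier)

  Domain = L n (k ∸ 1) ×ₛ L n (suc k)
  open Setoid Domain using () renaming (_≈_ to _≈ᴰ_)
  open Setoid (L n k ×ₛ L n k) using () renaming (_≈_ to _≈ᴸ_)

  fP fQ : Carrier Domain → Carrier (I n k ×ₛ I n k)
  fP (x , y) = Injection.to f (involutionP x , involutionP y)
  fQ (x , y) = Injection.to f (involutionQ x , involutionQ y)

  same : ∀ p → sh² (fP p) ≡ sh² (fQ p)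
  -- P and Q of a permutation have the same shape, so both arguments of `f` agree in shape.
  same (x , y) = f-shape _ _ (cong₂ _,_ (sh-PQ x) (sh-PQ y))

  a b c d : Carrier Domain → Carrier (I n k)
  a = proj₁ ∘ fP
  b = proj₂ ∘ fP
  c = proj₁ ∘ fQ
  d = proj₂ ∘ fQ

  same₁ : ∀ p → sh (proj₁ (a p)) ≡ sh (proj₁ (c p))
  same₁ p = cong proj₁ (same p)

  same₂ : ∀ p → sh (proj₁ (b p)) ≡ sh (proj₁ (d p))
  same₂ p = cong proj₂ (same p)

  F : Carrier Domain → Carrier (L n k ×ₛ L n k)
  F p = join (a p) (c p) (same₁ p) , join (b p) (d p) (same₂ p)

  F-cong : ∀ p q → p ≈ᴰ q → F p ≈ᴸ F q
  F-cong p@(x , y) q@(z , w) (x≈z , y≈w) =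
    join-cong (a p) (c p) (same₁ p) (a q) (c q) (same₁ q) (proj₁ eP) (proj₁ eQ) ,
    join-cong (b p) (d p) (same₂ p) (b q) (d q) (same₂ q) (proj₂ eP) (proj₂ eQ)
    where
    eP = Injection.cong f {involutionP x , involutionP y} {involutionP z , involutionP w}
           (involutionP-cong x z x≈z , involutionP-cong y w y≈w)
    eQ = Injection.cong f {involutionQ x , involutionQ y} {involutionQ z , involutionQ w}
           (involutionQ-cong x z x≈z , involutionQ-cong y w y≈w)

  F-injective : ∀ p q → F p ≈ᴸ F q → p ≈ᴰ q
  F-injective p@(x , y) q@(z , w) (e₁ , e₂) =
    involutionPQ-injective x z (proj₁ eP) (proj₁ eQ) , involutionPQ-injective y w (proj₂ eP) (proj₂ eQ)
    where
    -- The four involutions recovered from the joins make up both values of `f`, whose injectivity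
    -- then returns the P and the Q tableaux.
    j₁ = join-injective (a p) (c p) (same₁ p) (a q) (c q) (same₁ q) e₁
    j₂ = join-injective (b p) (d p) (same₂ p) (b q) (d q) (same₂ q) e₂
    eP = Injection.injective f {involutionP x , involutionP y} {involutionP z , involutionP w}
           (proj₁ j₁ , proj₁ j₂)
    eQ = Injection.injective f {involutionQ x , involutionQ y} {involutionQ z , involutionQ w}
           (proj₂ j₁ , proj₂ j₂)

  sh²-F : ∀ p → sh² (F p) ≡ sh² (fP p)
  sh²-F p = cong₂ _,_ (sh-joined (a p) (c p) (same₁ p)) (sh-joined (b p) (d p) (same₂ p))

  F-shape : ShapePreserving F
  -- `F p` has the shape of `fP p`, and `ι` preserves shapes, so the claim reduces to `f-shape`.
  F-shape p@(x , y) q@(z , w) e = trans (sh²-F p) (trans (f-shape _ _ (cong₂ _,_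
    (trans (sh-ι (proj₁ x)) (trans (cong proj₁ e) (sym (sh-ι (proj₁ z)))))
    (trans (sh-ι (proj₁ y)) (trans (cong proj₂ e) (sym (sh-ι (proj₁ w)))))))
    (sym (sh²-F q)))
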